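{- Let $t\ge 1$, and for $i=1,2,\dots,t$ let $n_i\ge 1$ and $k_i\ge 1$ be integers and let $\hat G(k_i,n_i)$ be an apex graph of an $n_i\times n_i$ grid with an apex set $X_i$, $|X_i|=k_i$, so that every vertex in $X_i$ is adjacent to all vertices of the $n_i\times n_i$ grid. Let $\hat G=\bigoplus_{i=1}^t \hat G(k_i,n_i)$ be a clique sum of these graphs, where the clique sums are taken only at apex sets. Then there are graphs $G_1$ and $G_2$ with $\hat G=G_1\cap G_2$ such that $G_1$ is chordal and $$ccw(G_2)\le \sum_{i=1}^t (n_i+k_i).$$
   Context: All graphs are finite, simple and undirected. A chordal graph is a graph with no chordless cycle (no induced cycle of length at least $4$). The $n\times n$ grid is the graph with vertex set $\{1,\dots,n\}^2$ in which $(a,b)$ and $(a',b')$ are adjacent if and only if $|a-a'|+|b-b'|=1$. The notation $\hat G(k,n)$ denotes any graph obtained from the $n\times n$ grid by adding a set $X$ of $k$ new vertices (the apex set), joining every vertex of $X$ to all $n^2$ grid vertices, and then possibly adding some edges among the vertices of $X$. Clique sum: let $H_1,H_2$ be graphs such that $V(H_1)\cap V(H_2)$ is a clique in both $H_1$ and $H_2$. A clique sum $H_1\oplus H_2$ is a graph $H$ with $V(H)=V(H_1)\cup V(H_2)$ and $E(H)=(E(H_1)\cup E(H_2))\setminus E'$, where $E'$ is a (possibly empty) subset of the edges of the clique induced by $V(H_1)\cap V(H_2)$. Clique sums of more than two graphs are defined iteratively: $\bigoplus_{i=1}^t H_i=(\cdots((H_1\oplus H_2)\oplus H_3)\cdots)\oplus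 H_t$. That the clique sums are taken only at apex sets means that, at each step, the vertices of the common clique are apex vertices of the graphs being summed, that is, grid vertices are never identified: the common clique in the step adding $\hat G(k_{i},n_{i})$ is contained in $X_{i}$ and in $X_1\cup\dots\cup X_{i-1}$. Edge intersection: $G=G_1\cap G_2$ means that $V(G)=V(G_1)=V(G_2)$ and $E(G)=E(G_1)\cap E(G_2)$. Clique cover width: a clique cover of $G$ is a partition of $V(G)$ into cliques. It is taken as an ordered list $C=\{C_0,C_1,\dots,C_s\}$. The width of $C$ is $w(C)=\max\{|j-i| : xy\in E(G),\ x\in C_i,\ y\in C_j\}$ (and $0$ if $G$ has no edges). The clique cover width $ccw(G)$ is the minimum of $w(C)$ over all ordered clique covers $C$ of $G$. -}

module Defs where

open import Level using (0ℓ; Lift)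
open import Data.Nat.Base using (ℕ; zero; suc; _+_; _≤_; ∣_-_∣)
open import Data.Fin.Base using (Fin; toℕ) renaming (zero to fzero)
open import Data.Fin.Subset using (Subset; _∈_; _∉_; _⊆_; _∩_; _∪_; ∣_∣; Nonempty)
open import Data.Vec.Base using (Vec; lookup)
open import Data.Vec.Functional using (Vector; init; last)
open import Data.Product.Base using (Σ-syntax; ∃-syntax; ∃₂; _×_)
open import Data.Sum.Base using (_⊎_)
open import Function.Bundles using (_⇔_)
open import Relation.Binary.Core using (Rel)
open import Relation.Binary.Definitions using (Symmetric; Irreflexive; Decidable)
open import Relation.Binary.PropositionalEquality.Core using (_≡_; _≢_)
open import Relation.Nullary.Negation.Core using (¬_)

-- Finite simple graphs whose vertices are drawn from a common finite pool
-- Fin N.  Distinct graphs may share vertices, so unions and intersections of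
-- vertex sets, as needed for clique sums and edge intersections, make sense.

record Graph (N : ℕ) : Set₁ where
  infix 4 _~_
  field
    V        : Subset N
    _~_      : Rel (Fin N) 0ℓ
    _~?_     : Decidable _~_
    ~-sym    : Symmetric _~_
    ~-irrefl : Irreflexive _≡_ _~_
    ~⇒∈V     : ∀ {u v} → u ~ v → u ∈ V

open Graph public using (V)

Adj : ∀ {N} → Graph N → Rel (Fin N) 0ℓ
Adj = Graph._~_

record _≈_ {N} (G H : Graph N) : Set where
  field
    vertices : V G ≡ V H
    edges    : ∀ u v → Adj G u v ⇔ Adj H u v

record _≈_∩ᴱ_ {N} (G G₁ G₂ : Graph N) : Set where
  field
    vertices₁ : V G ≡ V G₁
    vertices₂ : V G ≡ V G₂
    edges     : ∀ u v → Adj G u v ⇔ (Adj G₁ u v × Adj G₂ u v)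

record IsClique {N} (G : Graph N) (S : Subset N) : Set where
  field
    inV      : S ⊆ V G
    complete : ∀ {u v} → u ∈ S → v ∈ S → u ≢ v → Adj G u v

------------------------------------------------------------------------
-- Chordal graphs

-- Adjacency in the cycle 0, 1, …, m-1, 0 (for m ≥ 3).
CycleAdj : ∀ {m} → Rel (Fin m) 0ℓ
CycleAdj {m} i j = ∣ toℕ i - toℕ j ∣ ≡ 1 ⊎ suc ∣ toℕ i - toℕ j ∣ ≡ m

record InducedCycle {N} (G : Graph N) (m : ℕ) : Set where
  field
    vertex    : Fin m → Fin N
    injective : ∀ {i j} → vertex i ≡ vertex j → i ≡ j
    cycle     : ∀ {i j} → CycleAdj i j → Adj G (vertex i) (vertex j)
    chordless : ∀ {i j} → Adj G (vertex i) (vertex j) → CycleAdj i j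

Chordal : ∀ {N} → Graph N → Set
Chordal G = ∀ m → 4 ≤ m → ¬ InducedCycle G m

------------------------------------------------------------------------
-- Grids with apex vertices

GridAdj : ∀ {n} → (a b a′ b′ : Fin n) → Set
GridAdj a b a′ b′ = ∣ toℕ a - toℕ a′ ∣ + ∣ toℕ b - toℕ b′ ∣ ≡ 1

-- G is a graph Ĝ(k,n) with apex set X.  Edges inside X are unconstrained.
record IsApexGrid {N} (k n : ℕ) (G : Graph N) (X : Subset N) : Set where
  field
    grid           : Fin n → Fin n → Fin N
    grid-injective : ∀ {a b a′ b′} → grid a b ≡ grid a′ b′ → a ≡ a′ × b ≡ b′
    grid∉X         : ∀ a b → grid a b ∉ X
    ∣X∣≡k          : ∣ X ∣ ≡ k
    vertices       : ∀ v → v ∈ V G ⇔ (v ∈ X ⊎ ∃₂ λ a b → v ≡ grid a b)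
    grid-edges     : ∀ a b a′ b′ →
                     Adj G (grid a b) (grid a′ b′) ⇔ GridAdj a b a′ b′
    apex-edges     : ∀ {x} → x ∈ X → ∀ a b → Adj G x (grid a b)

------------------------------------------------------------------------
-- Clique sums

-- H is a clique sum of H₁ and H₂; E′ is the set of deleted clique edges.
record IsCliqueSum {N} (H₁ H₂ H : Graph N) : Set₁ where
  field
    clique₁  : IsClique H₁ (V H₁ ∩ V H₂)
    clique₂  : IsClique H₂ (V H₁ ∩ V H₂)
    E′       : Rel (Fin N) 0ℓ
    E′-sym   : Symmetric E′
    E′⊆      : ∀ {u v} → E′ u v →
               u ∈ V H₁ ∩ V H₂ × v ∈ V H₁ ∩ V H₂ × u ≢ v
    vertices : V H ≡ V H₁ ∪ V H₂
    edges    : ∀ u v → Adj H u v ⇔ ((Adj H₁ u v ⊎ Adj H₂ u v) × ¬ E′ u v)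

-- Ĝ is an iterated clique sum (⋯(H 0 ⊕ H 1) ⊕ ⋯) ⊕ H t in which each common
-- clique lies in the apex set of the graph being added and in the union of the
-- apex sets of the preceding graphs.
IsApexCliqueSum : ∀ {N} t → Vector (Graph N) (suc t) → Vector (Subset N) (suc t) →
                  Graph N → Set₁
IsApexCliqueSum     zero    H X Ĝ = Lift _ (Ĝ ≈ H fzero)
IsApexCliqueSum {N} (suc t) H X Ĝ =
  Σ[ H′ ∈ Graph N ]
    IsApexCliqueSum t (init H) (init X) H′ ×
    IsCliqueSum H′ (last H) Ĝ ×
    V H′ ∩ V (last H) ⊆ last X ×
    (∀ {v} → v ∈ V H′ ∩ V (last H) → ∃[ j ] v ∈ init X j)

------------------------------------------------------------------------
-- Clique cover width

record IsCliqueCover {N p} (G : Graph N) (C : Vec (Subset N) p) : Set where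
  field
    clique   : ∀ i → IsClique G (lookup C i)
    nonempty : ∀ i → Nonempty (lookup C i)
    disjoint : ∀ {i j v} → v ∈ lookup C i → v ∈ lookup C j → i ≡ j
    covers   : ∀ {v} → v ∈ V G → ∃[ i ] v ∈ lookup C i

-- d = |j - i| for some edge xy with x in the i-th and y in the j-th clique.
EdgeSpan : ∀ {N p} → Graph N → Vec (Subset N) p → ℕ → Set
EdgeSpan G C d =
  ∃₂ λ x y → ∃₂ λ i j →
    Adj G x y × x ∈ lookup C i × y ∈ lookup C j × d ≡ ∣ toℕ j - toℕ i ∣

record IsWidth {N p} (G : Graph N) (C : Vec (Subset N) p) (w : ℕ) : Set where
  field
    upper    : ∀ {d} → EdgeSpan G C d → d ≤ w
    attained : EdgeSpan G C w ⊎ ((∀ u v → ¬ Adj G u v) × w ≡ 0)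

CoverOfWidth : ∀ {N} → Graph N → ℕ → Set
CoverOfWidth {N} G w =
  ∃[ p ] Σ[ C ∈ Vec (Subset N) p ] IsCliqueCover G C × IsWidth G C w

-- The clique cover width of G is c.
record IsCCW {N} (G : Graph N) (c : ℕ) : Set where
  field
    attained : CoverOfWidth G c
    minimal  : ∀ {w} → CoverOfWidth G w → c ≤ w

{-# OPTIONS --safe #-}
-- G₂ is Ĝ with every column of every grid made complete.  Its vertices are
-- covered by the columns and by single apex vertices, and the width of a cover
-- is at most its number of cliques, here at most Σ (nᵢ + kᵢ).
-- In G₁ all apex vertices are adjacent, the vertices of Xᵢ are joined to the
-- i-th grid, and two vertices of that grid are adjacent when their row-major
-- positions differ by at most nᵢ.  Removing grid vertices in decreasing order
-- of position is a perfect elimination, so G₁ is chordal; and two vertices of a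
-- column at distance at least 2 have positions differing by at least 2 nᵢ, so
-- the edges added in G₂ are cancelled.
module Submission where

open import Defs
open import Data.Fin.Base using (Fin; zero; suc; toℕ; fromℕ; fromℕ<; inject₁)
open import Data.Fin.Properties as Fin
  using (toℕ<n; toℕ-fromℕ<; toℕ-injective; all?; any?)
open import Data.Fin.Relation.Unary.Top using (view; ‵fromℕ; ‵inject₁)
open import Data.Fin.Subset
  using (Subset; inside; outside; _∈_; _∉_; _⊆_; _∩_; ∁; ⋃; ⁅_⁆; ∣_∣; Nonempty)
open import Data.Fin.Subset.Properties
open import Data.List.Base as List using (List; []; _∷_; _++_; length; concat)
open import Data.List.Properties using (length-map; length-++; length-tabulate)
open import Data.List.Relation.Unary.All using (All; []; _∷_)
import Data.List.Relation.Unary.All.Properties as All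
open import Data.List.Relation.Unary.Any as Any using (Any; here; there)
import Data.List.Relation.Unary.Any.Properties as Any
open import Data.Nat.Base
open import Data.Nat.Properties
open import Data.Product.Base using (∃; ∃-syntax; ∃₂; _×_; _,_; proj₁; proj₂)
open import Data.Sum.Base using (_⊎_; inj₁; inj₂)
open import Data.Vec.Base using (Vec; []; _∷_; lookup; here; there)
open import Data.Vec.Functional using (Vector; init; last)
open import Function.Base using (_∘_)
open import Function.Bundles using (mk⇔; Equivalence)
open import Level using (0ℓ; lift)
open import Relation.Binary.Core using (Rel)
open import Relation.Binary.PropositionalEquality
open import Relation.Nullary.Decidable using (Dec; yes; no; map′; ¬?; _×-dec_; _⊎-dec_; _→-dec_)
open import Relation.Nullary.Negation using (¬_; contradiction)
open import Relation.Unary using (Decidable)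
open import Algebra.Properties.Monoid.Sum +-0-monoid using (sum-syntax; sum-cong-≗)

open Equivalence using (to; from)

-- Bounded search, finite subsets and lists

-- `IsCCW` demands a minimum that is attained; it is found by search below a known width, for which
-- the property has to be decidable.
least : ∀ {P : ℕ → Set} → Decidable P → ∀ b → P b →
        ∃[ c ] c ≤ b × P c × (∀ {d} → P d → c ≤ d)
least P? b pb with P? 0
... | yes p0 = 0 , z≤n , p0 , λ _ → z≤n
least P? zero pb | no ¬p0 = contradiction pb ¬p0
least {P} P? (suc b) pb | no ¬p0 with least (P? ∘ suc) b pb
... | c , c≤b , pc , c-least = suc c , s≤s c≤b , pc , bound
  where
  bound : ∀ {d} → P d → suc c ≤ d
  bound {zero}  p = contradiction p ¬p0
  bound {suc d} p = s≤s (c-least p)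

-- Serves to find the largest edge span of a cover. The second alternative is the case of an
-- edgeless graph.
greatest : ∀ {P : ℕ → Set} → Decidable P → ∀ b → (∀ {d} → P d → d ≤ b) →
           (∃[ c ] P c × (∀ {d} → P d → d ≤ c)) ⊎ (∀ d → ¬ P d)
greatest P? b bound with P? b
... | yes pb = inj₁ (b , pb , bound)
greatest {P} P? zero bound | no ¬p = inj₂ λ d p → ¬p (subst P (n≤0⇒n≡0 (bound p)) p)
greatest {P} P? (suc b) bound | no ¬p = greatest P? b λ p →
  s≤s⁻¹ (≤∧≢⇒< (bound p) λ eq → ¬p (subst P eq p))

argmax : ∀ {m} (f : Fin (suc m) → ℕ) → ∃[ i ] ∀ j → f j ≤ f i
argmax {zero}  f = zero , λ { zero → ≤-refl }
argmax {suc m} f with argmax (f ∘ suc)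
... | i , max with ≤-total (f zero) (f (suc i))
... | inj₁ le = suc i , λ { zero → le ; (suc j) → max j }
... | inj₂ ge = zero , λ { zero → ≤-refl ; (suc j) → ≤-trans (max j) ge }

-- There are finitely many families of `p` subsets, so the search over clique covers of a given
-- length terminates.
anyVec? : ∀ {N} p {P : Vec (Subset N) p → Set} → Decidable P → Dec (∃ P)
anyVec? zero    P? = map′ ([] ,_) (λ { ([] , q) → q }) (P? [])
anyVec? (suc p) P? =
  map′ (λ { (C , Cs , q) → C ∷ Cs , q }) (λ { (C ∷ Cs , q) → C , Cs , q })
       (anySubset? λ C → anyVec? p λ Cs → P? (C ∷ Cs))

x∈⋃⁺ : ∀ {N} {x : Fin N} {Cs} → Any (x ∈_) Cs → x ∈ ⋃ Cs
x∈⋃⁺ (here x∈C)   = x∈p∪q⁺ (inj₁ x∈C)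
x∈⋃⁺ (there x∈Cs) = x∈p∪q⁺ (inj₂ (x∈⋃⁺ x∈Cs))

x∈⋃⁻ : ∀ {N} {x : Fin N} Cs → x ∈ ⋃ Cs → Any (x ∈_) Cs
x∈⋃⁻ []       x∈⊥ = contradiction x∈⊥ ∉⊥
x∈⋃⁻ (C ∷ Cs) x∈ with x∈p∪q⁻ C (⋃ Cs) x∈
... | inj₁ x∈C  = here x∈C
... | inj₂ x∈Cs = there (x∈⋃⁻ Cs x∈Cs)

elements : ∀ {N} → Subset N → List (Fin N)
elements []            = []
elements (inside ∷ p)  = zero ∷ List.map suc (elements p)
elements (outside ∷ p) = List.map suc (elements p)

length-elements : ∀ {N} (p : Subset N) → length (elements p) ≡ ∣ p ∣
length-elements []            = refl
length-elements (inside ∷ p)  = cong suc (trans (length-map suc (elements p)) (length-elements p))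
length-elements (outside ∷ p) = trans (length-map suc (elements p)) (length-elements p)

∈-elements⁺ : ∀ {N} {x : Fin N} {p} → x ∈ p → Any (x ≡_) (elements p)
∈-elements⁺ {p = inside ∷ p}  here        = here refl
∈-elements⁺ {p = inside ∷ p}  (there x∈p) = there (Any.map⁺ (Any.map (cong suc) (∈-elements⁺ x∈p)))
∈-elements⁺ {p = outside ∷ p} (there x∈p) = Any.map⁺ (Any.map (cong suc) (∈-elements⁺ x∈p))

All-elements⁺ : ∀ {N} {P : Fin N → Set} p → (∀ {x} → x ∈ p → P x) → All P (elements p)
All-elements⁺ []            f = []
All-elements⁺ (inside ∷ p)  f = f here ∷ All.map⁺ (All-elements⁺ p (f ∘ there))
All-elements⁺ (outside ∷ p) f = All.map⁺ (All-elements⁺ p (f ∘ there))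

length-concat-tabulate : ∀ {A : Set} {t} (f : Fin t → List A) →
                         length (concat (List.tabulate f)) ≡ ∑[ i < t ] length (f i)
length-concat-tabulate {t = zero}  f = refl
length-concat-tabulate {t = suc t} f =
  trans (length-++ (f zero)) (cong (length (f zero) +_) (length-concat-tabulate (f ∘ suc)))

-- Chordal graphs

∣m+n-n∣≡m : ∀ m n → ∣ m + n - n ∣ ≡ m
∣m+n-n∣≡m m n = begin
  ∣ m + n - n ∣ ≡⟨ ∣-∣-comm (m + n) n ⟩
  ∣ n - m + n ∣ ≡⟨ cong ∣ n -_∣ (+-comm m n) ⟩
  ∣ n - n + m ∣ ≡⟨ ∣m-m+n∣≡n n m ⟩
  m             ∎
  where open ≡-Reasoning

-- The neighbours are the predecessor and the successor modulo the length `M`. They are at distance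
-- 2, or `M` - 2 when `i` is at either end of `Fin`; since `M` is at least 4, neither value is a
-- cycle adjacency.
cycle-neighbours : ∀ {m} → 4 ≤ m → (i : Fin m) →
                   ∃₂ λ j k → CycleAdj i j × CycleAdj i k × j ≢ k × ¬ CycleAdj j k
cycle-neighbours {suc (suc (suc (suc m)))} (s≤s (s≤s (s≤s (s≤s _)))) i = go (toℕ i) refl (toℕ<n i)
  where
  M = 4 + m

  -- A distance `d` strictly between 1 and `M` - 1 excludes both clauses of `CycleAdj`, and equality
  -- too.
  from-ℕ : ∀ {b c} → b < M → c < M →
           ∣ toℕ i - b ∣ ≡ 1 ⊎ suc ∣ toℕ i - b ∣ ≡ M →
           ∣ toℕ i - c ∣ ≡ 1 ⊎ suc ∣ toℕ i - c ∣ ≡ M →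
           ∀ {d} → ∣ b - c ∣ ≡ d → 1 < d → suc d < M →
           ∃₂ λ j k → CycleAdj i j × CycleAdj i k × j ≢ k × ¬ CycleAdj j k
  from-ℕ b<M c<M adjb adjc refl 1<d d<M
    with fromℕ< b<M | toℕ-fromℕ< b<M | fromℕ< c<M | toℕ-fromℕ< c<M
  ... | j | refl | k | refl =
    j , k , adjb , adjc ,
    (λ { refl → contradiction (subst (1 <_) (∣n-n∣≡0 (toℕ j)) 1<d) λ () }) ,
    λ { (inj₁ eq) → <-irrefl (sym eq) 1<d ; (inj₂ eq) → <-irrefl eq d<M }

  go : ∀ a → toℕ i ≡ a → a < M →
       ∃₂ λ j k → CycleAdj i j × CycleAdj i k × j ≢ k × ¬ CycleAdj j k
  go zero eq _ =
    from-ℕ {1} {3 + m} (s≤s (s≤s z≤n)) ≤-refl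
           (inj₁ (cong ∣_- 1 ∣ eq)) (inj₂ (cong (λ a → suc ∣ a - 3 + m ∣) eq))
           refl (s≤s (s≤s z≤n)) ≤-refl
  go (suc a) eq a<M with a ≟ 2 + m
  ... | yes refl =
    from-ℕ {2 + m} {0} (m≤n⇒m≤1+n ≤-refl) (s≤s z≤n)
           (inj₁ (trans (cong ∣_- 2 + m ∣ eq) (∣m+n-n∣≡m 1 m)))
           (inj₂ (cong (λ a → suc ∣ a - 0 ∣) eq))
           refl (s≤s (s≤s z≤n)) ≤-refl
  ... | no a≢2+m =
    from-ℕ {a} {2 + a} (<-trans (n<1+n a) a<M) (≤∧≢⇒< a<M (a≢2+m ∘ suc-injective ∘ suc-injective))
           (inj₁ (trans (cong ∣_- a ∣ eq) (∣m+n-n∣≡m 1 a)))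
           (inj₁ (trans (cong ∣_- 2 + a ∣ eq) (trans (∣-∣-comm a (1 + a)) (∣m+n-n∣≡m 1 a))))
           (trans (∣-∣-comm a (2 + a)) (∣m+n-n∣≡m 2 a)) ≤-refl (s≤s (s≤s (s≤s (s≤s z≤n))))

-- A vertex of maximal rank on an induced cycle is simplicial among the others,
-- so its two neighbours on the cycle would form a chord.
simplicial⇒chordal :
  ∀ {N} (G : Graph N) (rank : Fin N → ℕ) →
  (∀ {u v w} → Adj G v u → Adj G v w → rank u ≤ rank v → rank w ≤ rank v →
   u ≢ w → Adj G u w) →
  Chordal G
simplicial⇒chordal G rank simplicial (suc m) 4≤m C
  with argmax (rank ∘ InducedCycle.vertex C)
... | i , max with cycle-neighbours 4≤m i
... | j , k , i~j , i~k , j≢k , j≁k =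
  j≁k (chordless (simplicial (cycle i~j) (cycle i~k) (max j) (max k) (j≢k ∘ injective)))
  where open InducedCycle C

-- Clique cover width

clique? : ∀ {N} (G : Graph N) → Decidable (IsClique G)
clique? G S =
  map′ (λ (S⊆V , complete) → record
         { inV = λ {x} → S⊆V {x} ; complete = λ {u} {v} → complete u v })
       (λ c → (λ {x} → IsClique.inV c {x}) , λ u v → IsClique.complete c)
       (S ⊆? V G ×-dec all? λ u → all? λ v →
         u ∈? S →-dec v ∈? S →-dec ¬? (u Fin.≟ v) →-dec Graph._~?_ G u v)

cliqueCover? : ∀ {N p} (G : Graph N) → Decidable (IsCliqueCover {p = p} G)
cliqueCover? G C =
  map′ (λ (clique , nonempty , disjoint , covers) → record
         { clique = clique ; nonempty = nonempty
         ; disjoint = λ {i} {j} {v} → disjoint i j v ; covers = λ {v} → covers v })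
       (λ c → let open IsCliqueCover c in
         clique , nonempty , (λ i j v → disjoint) , λ v → covers)
       (all? (λ i → clique? G (lookup C i)) ×-dec
        all? (λ i → nonempty? (lookup C i)) ×-dec
        all? (λ i → all? λ j → all? λ v →
          v ∈? lookup C i →-dec v ∈? lookup C j →-dec i Fin.≟ j) ×-dec
        all? λ v → v ∈? V G →-dec any? λ i → v ∈? lookup C i)

edgeSpan? : ∀ {N p} (G : Graph N) (C : Vec (Subset N) p) → Decidable (EdgeSpan G C)
edgeSpan? G C d = any? λ x → any? λ y → any? λ i → any? λ j →
  Graph._~?_ G x y ×-dec x ∈? lookup C i ×-dec y ∈? lookup C j ×-dec
  d ≟ ∣ toℕ j - toℕ i ∣

-- All positions are below `p`, so this crude bound holds for every order of the cliques.
edgeSpan≤ : ∀ {N p} (G : Graph N) (C : Vec (Subset N) p) {d} → EdgeSpan G C d → d ≤ p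
edgeSpan≤ G C (_ , _ , i , j , _ , _ , _ , refl) =
  ≤-trans (∣m-n∣≤m⊔n (toℕ j) (toℕ i)) (<⇒≤ (⊔-lub (toℕ<n j) (toℕ<n i)))

-- Applied in both directions, it makes the width of a cover unique.
width≤ : ∀ {N p} {G : Graph N} {C : Vec (Subset N) p} {w w′} →
         IsWidth G C w → IsWidth G C w′ → w ≤ w′
width≤ isW isW′ with IsWidth.attained isW
... | inj₁ span     = IsWidth.upper isW′ span
... | inj₂ (_ , refl) = z≤n

cover⇒width : ∀ {N p} (G : Graph N) {C : Vec (Subset N) p} → IsCliqueCover G C →
              ∃[ w ] w ≤ p × IsWidth G C w
cover⇒width G {C} cover
  with greatest (edgeSpan? G C) _ (edgeSpan≤ G C)
... | inj₁ (w , span , max) =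
  w , edgeSpan≤ G C span , record { upper = max ; attained = inj₁ span }
-- A cover turns every edge into a span, so without spans there is no edge and the width is 0 by
-- convention.
... | inj₂ none = 0 , z≤n , record
  { upper    = λ span → contradiction span (none _)
  ; attained = inj₂ (edgeless , refl)
  }
  where
  open IsCliqueCover cover
  edgeless : ∀ u v → ¬ Adj G u v
  edgeless u v u~v =
    let i , u∈i = covers (Graph.~⇒∈V G u~v)
        j , v∈j = covers (Graph.~⇒∈V G (Graph.~-sym G u~v))
    in none _ (u , v , i , j , u~v , u∈i , v∈j , refl)

-- Choosing a member of each clique is injective by disjointness. This bounds the lengths to be
-- searched in `coverOfWidth?`.
coverSize≤ : ∀ {N p} {G : Graph N} {C : Vec (Subset N) p} → IsCliqueCover G C → p ≤ N
coverSize≤ cover = Fin.injective⇒≤ {f = λ i → proj₁ (nonempty i)} λ {i} {j} eq →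
  disjoint (proj₂ (nonempty i)) (subst (_∈ _) (sym eq) (proj₂ (nonempty j)))
  where open IsCliqueCover cover

coverOfWidth? : ∀ {N} (G : Graph N) → Decidable (CoverOfWidth G)
coverOfWidth? {N} G w =
  map′ (λ (p , _ , C , cw) → p , C , cw)
       (λ (p , C , cover , width) → p , s≤s (coverSize≤ cover) , C , cover , width)
       (anyUpTo? (λ p → anyVec? p coverOfWidthBy?) (suc N))
  where
  coverOfWidthBy? : ∀ {p} → Decidable λ (C : Vec (Subset N) p) → IsCliqueCover G C × IsWidth G C w
  coverOfWidthBy? C with cliqueCover? G C
  ... | no ¬cover = no (¬cover ∘ proj₁)
  -- The actual width `w′` is computed and compared with `w`; uniqueness of the width settles both
  -- answers.
  ... | yes cover with cover⇒width G cover
  ... | w′ , _ , isW′ =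
    map′ (λ { refl → cover , isW′ })
         (λ (_ , isW) → ≤-antisym (width≤ isW isW′) (width≤ isW′ isW))
         (w ≟ w′)

cover⇒ccw≤ : ∀ {N p} (G : Graph N) {C : Vec (Subset N) p} → IsCliqueCover G C →
             ∃[ c ] IsCCW G c × c ≤ p
cover⇒ccw≤ G {C} cover with cover⇒width G cover
... | w , w≤p , isW with least (coverOfWidth? G) w (_ , C , cover , isW)
... | c , c≤w , attained , minimal =
  c , record { attained = attained ; minimal = minimal } , ≤-trans c≤w w≤p

clique-⊆ : ∀ {N} {G : Graph N} {S T} → S ⊆ T → IsClique G T → IsClique G S
clique-⊆ S⊆T c = record
  { inV      = inV ∘ S⊆T
  ; complete = λ u∈S v∈S → complete (S⊆T u∈S) (S⊆T v∈S)
  }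
  where open IsClique c

-- Each clique is cut down to what the later ones miss and dropped if nothing remains, so the number
-- of cliques cannot grow, and subsets of cliques are cliques.
disjointify : ∀ {N} {G : Graph N} {Cs} → All (IsClique G) Cs →
              ∃₂ λ p (Ds : Vec (Subset N) p) →
                p ≤ length Cs ×
                (∀ i → IsClique G (lookup Ds i)) ×
                (∀ i → Nonempty (lookup Ds i)) ×
                (∀ {i j v} → v ∈ lookup Ds i → v ∈ lookup Ds j → i ≡ j) ×
                (∀ i → lookup Ds i ⊆ ⋃ Cs) ×
                (∀ {v} → v ∈ ⋃ Cs → ∃[ i ] v ∈ lookup Ds i)
disjointify [] =
  0 , [] , z≤n , (λ ()) , (λ ()) , (λ { {()} }) , (λ ()) , λ v∈⊥ → contradiction v∈⊥ ∉⊥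
disjointify {Cs = C ∷ Cs} (isC ∷ isCs) with disjointify isCs | nonempty? (C ∩ ∁ (⋃ Cs))
... | p , Ds , p≤ , clique , nonempty , disjoint , inside⋃ , covers | no empty =
  p , Ds , m≤n⇒m≤1+n p≤ , clique , nonempty , disjoint ,
  (λ i → x∈p∪q⁺ ∘ inj₂ ∘ inside⋃ i) , covers′
  where
  covers′ : ∀ {v} → v ∈ ⋃ (C ∷ Cs) → ∃[ i ] v ∈ lookup Ds i
  covers′ {v} v∈ with v ∈? ⋃ Cs | x∈p∪q⁻ C (⋃ Cs) v∈
  ... | yes v∈Cs | _         = covers v∈Cs
  ... | no  v∉Cs | inj₁ v∈C  = contradiction (v , x∈p∩q⁺ (v∈C , x∉p⇒x∈∁p v∉Cs)) empty
  ... | no  v∉Cs | inj₂ v∈Cs = contradiction v∈Cs v∉Cs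
... | p , Ds , p≤ , clique , nonempty , disjoint , inside⋃ , covers | yes new =
  suc p , D ∷ Ds , s≤s p≤ ,
  (λ { zero → clique-⊆ (proj₁ ∘ x∈p∩q⁻ C _) isC ; (suc i) → clique i }) ,
  (λ { zero → new ; (suc i) → nonempty i }) ,
  disjoint′ _ _ ,
  (λ { zero → x∈p∪q⁺ ∘ inj₁ ∘ proj₁ ∘ x∈p∩q⁻ C _
     ; (suc i) → x∈p∪q⁺ ∘ inj₂ ∘ inside⋃ i }) ,
  covers′
  where
  D = C ∩ ∁ (⋃ Cs)

  -- The induction carries `inside⋃` for this purpose: the older pieces stay inside `⋃ Cs`, which
  -- the new piece avoids.
  D∌ : ∀ {v} i → v ∈ D → ¬ v ∈ lookup Ds i
  D∌ i v∈D v∈i = x∈∁p⇒x∉p (proj₂ (x∈p∩q⁻ C _ v∈D)) (inside⋃ i v∈i)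

  disjoint′ : ∀ i j {v} → v ∈ lookup (D ∷ Ds) i → v ∈ lookup (D ∷ Ds) j → i ≡ j
  disjoint′ zero    zero    _ _ = refl
  disjoint′ zero    (suc j) p q = contradiction q (D∌ j p)
  disjoint′ (suc i) zero    p q = contradiction p (D∌ i q)
  disjoint′ (suc i) (suc j) p q = cong suc (disjoint p q)

  covers′ : ∀ {v} → v ∈ ⋃ (C ∷ Cs) → ∃[ i ] v ∈ lookup (D ∷ Ds) i
  covers′ {v} v∈ with v ∈? ⋃ Cs | x∈p∪q⁻ C (⋃ Cs) v∈
  ... | yes v∈Cs | _         = let i , v∈i = covers v∈Cs in suc i , v∈i
  ... | no  v∉Cs | inj₁ v∈C  = zero , x∈p∩q⁺ (v∈C , x∉p⇒x∈∁p v∉Cs)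
  ... | no  v∉Cs | inj₂ v∈Cs = contradiction v∈Cs v∉Cs

cliques⇒ccw≤ : ∀ {N} (G : Graph N) {Cs} → All (IsClique G) Cs →
               (∀ {v} → v ∈ V G → Any (v ∈_) Cs) →
               ∃[ c ] IsCCW G c × c ≤ length Cs
cliques⇒ccw≤ G isCs covers with disjointify isCs
... | _ , Ds , p≤ , clique , nonempty , disjoint , _ , ⋃-covers
  with cover⇒ccw≤ G {Ds} (record
    { clique = clique ; nonempty = nonempty ; disjoint = disjoint
    ; covers = ⋃-covers ∘ x∈⋃⁺ ∘ covers })
... | c , isCCW , c≤p = c , isCCW , ≤-trans c≤p p≤

-- Iterated clique sums at apex sets

cliqueSum-∈V⁻ : ∀ {N} t (H : Vector (Graph N) (suc t)) X Ĝ → IsApexCliqueSum t H X Ĝ →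
                ∀ {v} → v ∈ V Ĝ → ∃[ i ] v ∈ V (H i)
cliqueSum-∈V⁻ zero H X Ĝ (lift Ĝ≈H) v∈ = zero , subst (_ ∈_) (_≈_.vertices Ĝ≈H) v∈
cliqueSum-∈V⁻ (suc t) H X Ĝ (H′ , sum′ , step , _) v∈
  with x∈p∪q⁻ (V H′) _ (subst (_ ∈_) (IsCliqueSum.vertices step) v∈)
... | inj₁ v∈H′ = let i , v∈i = cliqueSum-∈V⁻ t (init H) (init X) H′ sum′ v∈H′ in inject₁ i , v∈i
... | inj₂ v∈H  = fromℕ (suc t) , v∈H

cliqueSum-∈V⁺ : ∀ {N} t (H : Vector (Graph N) (suc t)) X Ĝ → IsApexCliqueSum t H X Ĝ →
                ∀ i {v} → v ∈ V (H i) → v ∈ V Ĝ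
cliqueSum-∈V⁺ zero H X Ĝ (lift Ĝ≈H) zero v∈ = subst (_ ∈_) (sym (_≈_.vertices Ĝ≈H)) v∈
cliqueSum-∈V⁺ (suc t) H X Ĝ (H′ , sum′ , step , _) i v∈ =
  subst (_ ∈_) (sym (IsCliqueSum.vertices step)) (x∈p∪q⁺ (split i v∈))
  where
  split : ∀ i {v} → v ∈ V (H i) → v ∈ V H′ ⊎ v ∈ V (last H)
  split i v∈ with view i
  ... | ‵fromℕ     = inj₂ v∈
  ... | ‵inject₁ j = inj₁ (cliqueSum-∈V⁺ t (init H) (init X) H′ sum′ j v∈)

cliqueSum-adj⁻ : ∀ {N} t (H : Vector (Graph N) (suc t)) X Ĝ → IsApexCliqueSum t H X Ĝ →
                 ∀ {u v} → Adj Ĝ u v → ∃[ i ] Adj (H i) u v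
cliqueSum-adj⁻ zero H X Ĝ (lift Ĝ≈H) u~v = zero , to (_≈_.edges Ĝ≈H _ _) u~v
cliqueSum-adj⁻ (suc t) H X Ĝ (H′ , sum′ , step , _) u~v
  with proj₁ (to (IsCliqueSum.edges step _ _) u~v)
... | inj₁ u~v′ = let i , u~v-i = cliqueSum-adj⁻ t (init H) (init X) H′ sum′ u~v′ in inject₁ i , u~v-i
... | inj₂ u~v′ = fromℕ (suc t) , u~v′

-- This is how the restriction to apex sets is used: grid vertices are never identified. Induction
-- on the number of summands, according to which of `i` and `j` is the newest.
cliqueSum-shared : ∀ {N} t (H : Vector (Graph N) (suc t)) X Ĝ →
                   (∀ i → X i ⊆ V (H i)) → IsApexCliqueSum t H X Ĝ →
                   ∀ {i j v} → i ≢ j → v ∈ V (H i) → v ∈ V (H j) → v ∈ X i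
cliqueSum-shared zero H X Ĝ X⊆V _ {zero} {zero} i≢j _ _ = contradiction refl i≢j
cliqueSum-shared (suc t) H X Ĝ X⊆V (H′ , sum′ , step , ⊆last , ∈init) {i} {j} i≢j v∈i v∈j
  with view i | view j
... | ‵fromℕ     | ‵fromℕ      = contradiction refl i≢j
... | ‵inject₁ i | ‵inject₁ j  =
  cliqueSum-shared t (init H) (init X) H′ (X⊆V ∘ inject₁) sum′ (i≢j ∘ cong inject₁) v∈i v∈j
... | ‵fromℕ     | ‵inject₁ j  =
  ⊆last (x∈p∩q⁺ (cliqueSum-∈V⁺ t (init H) (init X) H′ sum′ j v∈j , v∈i))
... | ‵inject₁ i | ‵fromℕ
  with ∈init (x∈p∩q⁺ (cliqueSum-∈V⁺ t (init H) (init X) H′ sum′ i v∈i , v∈j))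
-- The hypothesis only puts `v` into some earlier apex set `X l`. If `l` differs from `i`, then `v`
-- is shared by the summands `l` and `i`, and the induction hypothesis applies.
... | l , v∈l with i Fin.≟ l
... | yes refl = v∈l
... | no  i≢l  =
  cliqueSum-shared t (init H) (init X) H′ (X⊆V ∘ inject₁) sum′ i≢l v∈i (X⊆V (inject₁ l) v∈l)

-- Only edges inside a common clique are ever deleted, and these lie in the apex set.
cliqueSum-adj⁺ : ∀ {N} t (H : Vector (Graph N) (suc t)) X Ĝ →
                 (∀ i → X i ⊆ V (H i)) → IsApexCliqueSum t H X Ĝ →
                 ∀ i {u v} → u ∉ X i → Adj (H i) u v → Adj Ĝ u v
cliqueSum-adj⁺ zero H X Ĝ X⊆V (lift Ĝ≈H) zero _ u~v = from (_≈_.edges Ĝ≈H _ _) u~v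
cliqueSum-adj⁺ (suc t) H X Ĝ X⊆V S@(H′ , sum′ , step , ⊆last , ∈init) i {u} {v} u∉X u~v =
  from (IsCliqueSum.edges step u v)
       (kept i u∉X u~v , λ e → u∉X (common i u~v (proj₁ (IsCliqueSum.E′⊆ step e))))
  where
  kept : ∀ i → u ∉ X i → Adj (H i) u v → Adj H′ u v ⊎ Adj (last H) u v
  kept i u∉X u~v with view i
  ... | ‵fromℕ     = inj₂ u~v
  ... | ‵inject₁ j = inj₁ (cliqueSum-adj⁺ t (init H) (init X) H′ (X⊆V ∘ inject₁) sum′ j u∉X u~v)

  -- For the newest summand this is `⊆last`; an earlier summand shares `u` with the newest one, so
  -- `cliqueSum-shared` applies.
  common : ∀ i → Adj (H i) u v → u ∈ V H′ ∩ V (last H) → u ∈ X i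
  common i u~v u∈ with view i
  ... | ‵fromℕ     = ⊆last u∈
  ... | ‵inject₁ j = cliqueSum-shared (suc t) H X Ĝ X⊆V S (Fin.fromℕ≢inject₁ ∘ sym)
    (Graph.~⇒∈V (H (inject₁ j)) u~v) (proj₂ (x∈p∩q⁻ (V H′) _ u∈))

-- Row-major positions

∣m+n-o+p∣≤∣m-o∣+∣n-p∣ : ∀ m n o p → ∣ m + n - o + p ∣ ≤ ∣ m - o ∣ + ∣ n - p ∣
∣m+n-o+p∣≤∣m-o∣+∣n-p∣ m n o p = begin
  ∣ m + n - o + p ∣                     ≤⟨ ∣-∣-triangle (m + n) (o + n) (o + p) ⟩
  ∣ m + n - o + n ∣ + ∣ o + n - o + p ∣ ≡⟨ cong₂ (λ x y → ∣ x - y ∣ + ∣ o + n - o + p ∣) (+-comm m n) (+-comm o n) ⟩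
  ∣ n + m - n + o ∣ + ∣ o + n - o + p ∣ ≡⟨ cong₂ _+_ (∣m+n-m+o∣≡∣n-o∣ n m o) (∣m+n-m+o∣≡∣n-o∣ o n p) ⟩
  ∣ m - o ∣ + ∣ n - p ∣                 ∎
  where open ≤-Reasoning

position : ℕ → ℕ → ℕ → ℕ
position n a b = a * n + b

-- A step within a column shifts the position by `n`, a step within a row by 1, which is at most
-- `n`.
gridAdj⇒near : ∀ {n} → 1 ≤ n → ∀ a b c d → ∣ a - c ∣ + ∣ b - d ∣ ≡ 1 →
               ∣ position n a b - position n c d ∣ ≤ n
gridAdj⇒near {n} 1≤n a b c d adj = begin
  ∣ a * n + b - c * n + d ∣     ≤⟨ ∣m+n-o+p∣≤∣m-o∣+∣n-p∣ (a * n) b (c * n) d ⟩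
  ∣ a * n - c * n ∣ + ∣ b - d ∣ ≡⟨ cong (_+ ∣ b - d ∣) (*-distribʳ-∣-∣ n a c) ⟨
  ∣ a - c ∣ * n + ∣ b - d ∣     ≤⟨ weighted ∣ a - c ∣ ∣ b - d ∣ adj ⟩
  n                             ∎
  where
  open ≤-Reasoning
  weighted : ∀ x y → x + y ≡ 1 → x * n + y ≤ n
  weighted zero       y eq   = subst (_≤ n) (sym eq) 1≤n
  weighted (suc zero) zero _ = ≤-reflexive (trans (+-identityʳ _) (+-identityʳ n))

-- Within a column, positions differ by `n` times the row distance. Cancelling `n` leaves a row
-- distance of at most 1, and it is not 0.
near-sameColumn⇒gridAdj : ∀ {n} → 1 ≤ n → ∀ {a c} b → a ≢ c →
                          ∣ position n a b - position n c b ∣ ≤ n →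
                          ∣ a - c ∣ + ∣ b - b ∣ ≡ 1
near-sameColumn⇒gridAdj {suc n} _ {a} {c} b a≢c near =
  trans (cong (∣ a - c ∣ +_) (∣n-n∣≡0 b)) (trans (+-identityʳ _)
    (≤-antisym (*-cancelʳ-≤ _ 1 (suc n) (begin
        ∣ a - c ∣ * suc n             ≡⟨ *-distribʳ-∣-∣ (suc n) a c ⟩
        ∣ a * suc n - c * suc n ∣     ≡⟨ ∣m+n-m+o∣≡∣n-o∣ b (a * suc n) (c * suc n) ⟨
        ∣ b + a * suc n - b + c * suc n ∣ ≡⟨ cong₂ ∣_-_∣ (+-comm b _) (+-comm b _) ⟩
        ∣ a * suc n + b - c * suc n + b ∣ ≤⟨ near ⟩
        suc n                         ≡⟨ *-identityˡ (suc n) ⟨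
        1 * suc n                     ∎))
      (n≢0⇒n>0 (a≢c ∘ ∣m-n∣≡0⇒m≡n))))
  where open ≤-Reasoning

∣m-n∣≤o : ∀ {m n o} → m ≤ n + o → n ≤ m + o → ∣ m - n ∣ ≤ o
∣m-n∣≤o {m} {n} m≤n+o n≤m+o with ∣m-n∣≡[m∸n]∨[n∸m] m n
... | inj₁ eq = subst (_≤ _) (sym eq) (m≤n+o⇒m∸n≤o m n m≤n+o)
... | inj₂ eq = subst (_≤ _) (sym eq) (m≤n+o⇒m∸n≤o n m n≤m+o)

-- Both `y` and `z` lie in the window of length `n` that ends at `x`.
near-below : ∀ {n x y z} → y ≤ x → z ≤ x → ∣ x - y ∣ ≤ n → ∣ x - z ∣ ≤ n → ∣ y - z ∣ ≤ n
near-below {n} {x} {y} {z} y≤x z≤x x-y x-z =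
  ∣m-n∣≤o (bound y≤x x-z) (bound z≤x x-y)
  where
  bound : ∀ {y z} → y ≤ x → ∣ x - z ∣ ≤ n → y ≤ z + n
  bound {z = z} y≤x x-z = ≤-trans y≤x (≤-trans (m≤n+∣m-n∣ x z) (+-monoʳ-≤ z x-z))

-- Labels and the adjacency rules on them

-- Coordinates replace pool vertices, so that adjacency can be defined by cases. Natural numbers as
-- rows and columns avoid a dependency on the size of the grid.
data Label (N T : ℕ) : Set where
  apex : Fin N → Label N T
  grid : Fin T → (row column : ℕ) → Label N T

data SameColumn {N T} : Rel (Label N T) 0ℓ where
  sameColumn : ∀ {i a c b} → SameColumn (grid i a b) (grid i c b)

sameColumn? : ∀ {N T} (x y : Label N T) → Dec (SameColumn x y)
sameColumn? (apex _)     (apex _)     = no λ ()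
sameColumn? (apex _)     (grid _ _ _) = no λ ()
sameColumn? (grid _ _ _) (apex _)     = no λ ()
sameColumn? (grid i a b) (grid j c d) =
  map′ (λ { (refl , refl) → sameColumn }) (λ { sameColumn → refl , refl })
       (i Fin.≟ j ×-dec b ≟ d)

sameColumn-sym : ∀ {N T} {x y : Label N T} → SameColumn x y → SameColumn y x
sameColumn-sym sameColumn = sameColumn

module _ {N T} (n : Vector ℕ T) (X : Vector (Subset N) T) where

  -- Linking all apex labels, across summands, is harmless: between apex vertices `G₂` has just the
  -- edges of `Ĝ`.
  data Linked : Rel (Label N T) 0ℓ where
    apex-apex : ∀ {u v} → Linked (apex u) (apex v)
    apex-grid : ∀ {u i a b} → u ∈ X i → Linked (apex u) (grid i a b)
    grid-apex : ∀ {u i a b} → u ∈ X i → Linked (grid i a b) (apex u)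
    grid-grid : ∀ {i a b c d} → ∣ position (n i) a b - position (n i) c d ∣ ≤ n i →
                Linked (grid i a b) (grid i c d)

  linked? : ∀ x y → Dec (Linked x y)
  linked? (apex u)     (apex v)     = yes apex-apex
  linked? (apex u)     (grid i a b) = map′ apex-grid (λ { (apex-grid p) → p }) (u ∈? X i)
  linked? (grid i a b) (apex u)     = map′ grid-apex (λ { (grid-apex p) → p }) (u ∈? X i)
  linked? (grid i a b) (grid j c d) with i Fin.≟ j
  ... | no  i≢j  = no λ { (grid-grid _) → i≢j refl }
  ... | yes refl = map′ grid-grid (λ { (grid-grid p) → p }) (_ ≤? n i)

  linked-sym : ∀ {x y} → Linked x y → Linked y x
  linked-sym apex-apex     = apex-apex
  linked-sym (apex-grid p) = grid-apex p
  linked-sym (grid-apex p) = apex-grid p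
  linked-sym (grid-grid {i} {a} {b} {c} {d} p) =
    grid-grid (subst (_≤ n i) (∣-∣-comm (position (n i) a b) (position (n i) c d)) p)

  -- The shift by one puts every grid label above all apex labels. Ties between different grids do
  -- no harm, as such labels are never linked.
  rank : Label N T → ℕ
  rank (apex _)     = 0
  rank (grid i a b) = suc (position (n i) a b)

  -- Below a grid label there are linked to it only apex vertices of its own summand and a window of
  -- positions in its own grid. Below an apex label there are only apex labels, so the cases left
  -- out are absurd.
  linked-simplicial : ∀ {x y z} → Linked x y → Linked x z →
                      rank y ≤ rank x → rank z ≤ rank x → Linked y z
  linked-simplicial apex-apex     apex-apex     _ _ = apex-apex
  linked-simplicial (grid-apex p) (grid-apex q) _ _ = apex-apex
  linked-simplicial (grid-apex p) (grid-grid q) _ _ = apex-grid p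
  linked-simplicial (grid-grid p) (grid-apex q) _ _ = grid-apex q
  linked-simplicial (grid-grid p) (grid-grid q) (s≤s y≤x) (s≤s z≤x) =
    grid-grid (near-below y≤x z≤x p q)

-- Labelling the vertices of the clique sum

module Construction
  {N : ℕ} (t : ℕ) (n k : Vector ℕ (suc t)) (1≤n : ∀ i → 1 ≤ n i)
  (H : Vector (Graph N) (suc t)) (X : Vector (Subset N) (suc t))
  (isApexGrid : ∀ i → IsApexGrid (k i) (n i) (H i) (X i))
  (Ĝ : Graph N) (isSum : IsApexCliqueSum t H X Ĝ)
  where

  open module ApexGrid i = IsApexGrid (isApexGrid i) using (∣X∣≡k; grid∉X) renaming (grid to point)

  ∈V : ∀ i {v} → v ∈ X i ⊎ (∃₂ λ a b → v ≡ point i a b) → v ∈ V (H i)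
  ∈V i = from (ApexGrid.vertices i _)

  X⊆V : ∀ i → X i ⊆ V (H i)
  X⊆V i = ∈V i ∘ inj₁

  V⊆Ĝ : ∀ i → V (H i) ⊆ V Ĝ
  V⊆Ĝ i = cliqueSum-∈V⁺ t H X Ĝ isSum i

  point∈V : ∀ i a b → point i a b ∈ V (H i)
  point∈V i a b = ∈V i (inj₂ (a , b , refl))

  -- A shared vertex would be an apex vertex, which a grid vertex is not. Labels are well defined
  -- for this reason.
  point-unshared : ∀ {i j a b} → point i a b ∈ V (H j) → i ≡ j
  point-unshared {i} {j} {a} {b} ∈j with i Fin.≟ j
  ... | yes i≡j = i≡j
  ... | no  i≢j = contradiction
    (cliqueSum-shared t H X Ĝ X⊆V isSum i≢j (point∈V i a b) ∈j) (grid∉X i a b)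

  IsPoint : Fin N → Set
  IsPoint v = ∃[ i ] ∃₂ λ a b → v ≡ point i a b

  isPoint? : ∀ v → Dec (IsPoint v)
  isPoint? v = any? λ i → any? λ a → any? λ b → v Fin.≟ point i a b

  -- Junk value: vertices of the pool outside Ĝ are labelled apex too.
  label : Fin N → Label N (suc t)
  label v with isPoint? v
  ... | yes (i , a , b , _) = grid i (toℕ a) (toℕ b)
  ... | no _                = apex v

  -- The search in `isPoint?` returns some coordinates; `point-unshared` and injectivity of the grid
  -- identify them with the given ones.
  label-point : ∀ i a b → label (point i a b) ≡ grid i (toℕ a) (toℕ b)
  label-point i a b with isPoint? (point i a b)
  ... | no ¬p = contradiction (i , a , b , refl) ¬p
  ... | yes (j , c , d , eq) with point-unshared (subst (_∈ V (H j)) (sym eq) (point∈V j c d))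
  ... | refl with ApexGrid.grid-injective i eq
  ... | refl , refl = refl

  label-apex : ∀ {i v} → v ∈ X i → label v ≡ apex v
  label-apex {i} {v} v∈X with isPoint? v
  ... | no _ = refl
  ... | yes (j , a , b , refl) with point-unshared {j} {i} (X⊆V i v∈X)
  ... | refl = contradiction v∈X (grid∉X j a b)

  label-grid⁻ : ∀ {v i r c} → label v ≡ grid i r c →
                ∃₂ λ a b → v ≡ point i a b × r ≡ toℕ a × c ≡ toℕ b
  label-grid⁻ {v} eq with isPoint? v
  label-grid⁻ refl | yes (i , a , b , v≡) = a , b , v≡ , refl , refl
  label-grid⁻ ()   | no _

  -- The two supergraphs and their intersection

  G₁ : Graph N
  G₁ = record
    { V        = V Ĝ
    -- `Linked` is reflexive and pool vertices outside `Ĝ` carry apex labels; the further conjuncts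
    -- exclude loops and such vertices.
    ; _~_      = λ u v → u ≢ v × u ∈ V Ĝ × v ∈ V Ĝ × Linked n X (label u) (label v)
    ; _~?_     = λ u v → ¬? (u Fin.≟ v) ×-dec u ∈? V Ĝ ×-dec v ∈? V Ĝ ×-dec
                         linked? n X (label u) (label v)
    ; ~-sym    = λ (u≢v , u∈ , v∈ , l) → u≢v ∘ sym , v∈ , u∈ , linked-sym n X l
    ; ~-irrefl = λ u≡v (u≢v , _) → u≢v u≡v
    ; ~⇒∈V     = λ (_ , u∈ , _) → u∈
    }

  G₁-chordal : Chordal G₁
  G₁-chordal = simplicial⇒chordal G₁ (rank n X ∘ label)
    λ (_ , _ , u∈ , v-u) (_ , _ , w∈ , v-w) u≤v w≤v u≢w →
      u≢w , u∈ , w∈ , linked-simplicial n X v-u v-w u≤v w≤v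

  G₂ : Graph N
  G₂ = record
    { V        = V Ĝ
    ; _~_      = λ u v → Adj Ĝ u v ⊎
                   (u ≢ v × u ∈ V Ĝ × v ∈ V Ĝ × SameColumn (label u) (label v))
    ; _~?_     = λ u v → Graph._~?_ Ĝ u v ⊎-dec
                   (¬? (u Fin.≟ v) ×-dec u ∈? V Ĝ ×-dec v ∈? V Ĝ ×-dec
                    sameColumn? (label u) (label v))
    ; ~-sym    = λ { (inj₁ u~v) → inj₁ (Graph.~-sym Ĝ u~v)
                   ; (inj₂ (u≢v , u∈ , v∈ , s)) → inj₂ (u≢v ∘ sym , v∈ , u∈ , sameColumn-sym s) }
    ; ~-irrefl = λ { u≡v (inj₁ u~v) → Graph.~-irrefl Ĝ u≡v u~v
                   ; u≡v (inj₂ (u≢v , _)) → u≢v u≡v }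
    ; ~⇒∈V     = λ { (inj₁ u~v) → Graph.~⇒∈V Ĝ u~v ; (inj₂ (_ , u∈ , _)) → u∈ }
    }

  -- Gives that `G₁` contains `Ĝ`, since every edge of the sum stems from a summand.
  adj⇒linked : ∀ {i u v} → Adj (H i) u v → Linked n X (label u) (label v)
  adj⇒linked {i} {u} {v} u~v
    with to (ApexGrid.vertices i u) (Graph.~⇒∈V (H i) u~v)
       | to (ApexGrid.vertices i v) (Graph.~⇒∈V (H i) (Graph.~-sym (H i) u~v))
  ... | inj₁ u∈X            | inj₁ v∈X
    rewrite label-apex u∈X | label-apex v∈X = apex-apex
  ... | inj₁ u∈X            | inj₂ (a , b , refl)
    rewrite label-apex u∈X | label-point i a b = apex-grid u∈X
  ... | inj₂ (a , b , refl) | inj₁ v∈X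
    rewrite label-apex v∈X | label-point i a b = grid-apex v∈X
  ... | inj₂ (a , b , refl) | inj₂ (c , d , refl)
    rewrite label-point i a b | label-point i c d =
    grid-grid (gridAdj⇒near (1≤n i) (toℕ a) (toℕ b) (toℕ c) (toℕ d)
                (to (ApexGrid.grid-edges i a b c d) u~v))

  -- The edges added in `G₂` survive in `G₁` only where `Ĝ` has them already. The labels are
  -- variables with equations so that both relations can be matched on.
  linked-sameColumn⇒adj : ∀ {u v x y} → label u ≡ x → label v ≡ y → u ≢ v →
                          Linked n X x y → SameColumn x y → Adj Ĝ u v
  linked-sameColumn⇒adj u-x v-y u≢v (grid-grid {i} near) sameColumn
    with label-grid⁻ u-x | label-grid⁻ v-y
  ... | a , b , refl , refl , refl | c , d , refl , refl , b≡d with toℕ-injective b≡d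
  -- The edge has an end outside the apex set, so no clique sum deletes it.
  ... | refl = cliqueSum-adj⁺ t H X Ĝ X⊆V isSum i (grid∉X i a b)
    (from (ApexGrid.grid-edges i a b c b)
      (near-sameColumn⇒gridAdj (1≤n i) (toℕ b)
        (λ a≡c → u≢v (cong (λ a → point i a b) (toℕ-injective a≡c))) near))

  Ĝ≈G₁∩G₂ : Ĝ ≈ G₁ ∩ᴱ G₂
  Ĝ≈G₁∩G₂ = record
    { vertices₁ = refl
    ; vertices₂ = refl
    ; edges     = λ u v → mk⇔
        (λ u~v → ( (λ u≡v → Graph.~-irrefl Ĝ u≡v u~v)
                 , Graph.~⇒∈V Ĝ u~v , Graph.~⇒∈V Ĝ (Graph.~-sym Ĝ u~v)
                 , adj⇒linked (proj₂ (cliqueSum-adj⁻ t H X Ĝ isSum u~v)))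
                 , inj₁ u~v)
        λ { (_ , inj₁ u~v) → u~v
          ; ((u≢v , _ , _ , l) , inj₂ (_ , _ , _ , s)) →
              linked-sameColumn⇒adj refl refl u≢v l s }
    }

  -- The clique cover by columns and apex vertices

  column : ∀ i → Fin (n i) → Subset N
  column i b = ⋃ (List.tabulate λ a → ⁅ point i a b ⁆)

  ∈column⁻ : ∀ i b {v} → v ∈ column i b → ∃[ a ] v ≡ point i a b
  ∈column⁻ i b v∈ = let a , v∈a = Any.tabulate⁻ (x∈⋃⁻ _ v∈) in a , x∈⁅y⁆⇒x≡y _ v∈a

  point∈column : ∀ i a b → point i a b ∈ column i b
  point∈column i a b = x∈⋃⁺ (Any.tabulate⁺ a (x∈⁅x⁆ _))

  column-clique : ∀ i b → IsClique G₂ (column i b)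
  column-clique i b = record
    { inV      = column⊆V
    ; complete = λ u∈ v∈ u≢v → inj₂ (u≢v , column⊆V u∈ , column⊆V v∈ , together u∈ v∈)
    }
    where
    column⊆V : column i b ⊆ V Ĝ
    column⊆V v∈ with ∈column⁻ i b v∈
    ... | a , refl = V⊆Ĝ i (point∈V i a b)

    together : ∀ {u v} → u ∈ column i b → v ∈ column i b → SameColumn (label u) (label v)
    together u∈ v∈ with ∈column⁻ i b u∈ | ∈column⁻ i b v∈
    ... | a , refl | c , refl rewrite label-point i a b | label-point i c b = sameColumn

  singleton-clique : ∀ {v} → v ∈ V Ĝ → IsClique G₂ ⁅ v ⁆
  singleton-clique {v} v∈ = record
    { inV      = λ u∈ → subst (_∈ V Ĝ) (sym (x∈⁅y⁆⇒x≡y v u∈)) v∈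
    ; complete = λ u∈ w∈ u≢w →
        contradiction (trans (x∈⁅y⁆⇒x≡y v u∈) (sym (x∈⁅y⁆⇒x≡y v w∈))) u≢w
    }

  -- An apex vertex common to several summands is listed once for each. The repetitions make the
  -- count exactly the sum in the bound; `disjointify` removes them afterwards.
  cliquesAt : Fin (suc t) → List (Subset N)
  cliquesAt i = List.tabulate (column i) ++ List.map ⁅_⁆ (elements (X i))

  cliques : List (Subset N)
  cliques = concat (List.tabulate cliquesAt)

  length-cliques : length cliques ≡ ∑[ i < suc t ] (n i + k i)
  length-cliques = trans (length-concat-tabulate cliquesAt) (sum-cong-≗ λ i →
    trans (length-++ (List.tabulate (column i)) {List.map ⁅_⁆ (elements (X i))})
      (cong₂ _+_ (length-tabulate (column i))
        (trans (length-map ⁅_⁆ (elements (X i))) (trans (length-elements (X i)) (∣X∣≡k i)))))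

  all-cliques : All (IsClique G₂) cliques
  all-cliques = All.concat⁺ (All.tabulate⁺ {f = cliquesAt} λ i → All.++⁺
    (All.tabulate⁺ (column-clique i))
    (All.map⁺ (All-elements⁺ (X i) (singleton-clique ∘ V⊆Ĝ i ∘ X⊆V i))))

  cliques-cover : ∀ {v} → v ∈ V Ĝ → Any (v ∈_) cliques
  cliques-cover {v} v∈ with cliqueSum-∈V⁻ t H X Ĝ isSum v∈
  ... | i , v∈i = Any.concat⁺ (Any.tabulate⁺ {f = cliquesAt} i (at (to (ApexGrid.vertices i v) v∈i)))
    where
    at : v ∈ X i ⊎ (∃₂ λ a b → v ≡ point i a b) → Any (v ∈_) (cliquesAt i)
    at (inj₁ v∈X)            = Any.++⁺ʳ (List.tabulate (column i))
      (Any.map⁺ (Any.map (λ { refl → x∈⁅x⁆ v }) (∈-elements⁺ v∈X)))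
    at (inj₂ (a , b , refl)) = Any.++⁺ˡ (Any.tabulate⁺ b (point∈column i a b))

theorem2p2 : ∀ {N} t (n k : Vector ℕ (suc t)) →
    (∀ i → 1 ≤ n i) → (∀ i → 1 ≤ k i) →
    (H : Vector (Graph N) (suc t)) (X : Vector (Subset N) (suc t)) →
    (∀ i → IsApexGrid (k i) (n i) (H i) (X i)) →
    (Ĝ : Graph N) → IsApexCliqueSum t H X Ĝ →
    ∃₂ λ (G₁ G₂ : Graph N) →
    Ĝ ≈ G₁ ∩ᴱ G₂ × Chordal G₁ ×
    (∃[ c ] IsCCW G₂ c × c ≤ ∑[ i < suc t ] (n i + k i))
theorem2p2 t n k 1≤n _ H X isApexGrid Ĝ isSum =
  G₁ , G₂ , Ĝ≈G₁∩G₂ , G₁-chordal ,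
  subst (λ s → ∃[ c ] IsCCW G₂ c × c ≤ s) length-cliques
        (cliques⇒ccw≤ G₂ all-cliques cliques-cover)
  where open Construction t n k 1≤n H X isApexGrid Ĝ isSum
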